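{- Let $\mathcal{L}$ be a monochromatic graphical language with underlying prop $\mathbf{L}$ and scalable prop $\mathcal{S}\mathbf{L}$. Let $\{\_\}:\mathcal{S}\mathbf{L}\to\mathbf{L}$ be the wire stripper functor, let $!:\mathcal{S}\mathbf{L}\to\mathbf{1}_{\mathbb{N}_{>0}}$ and $!:\mathbf{L}\to\mathbf{N}$ be the unique (identity-on-objects) morphisms to the terminal $\mathbb{N}_{>0}$-colored prop and the terminal monochromatic prop respectively, and let $[\_]:\mathbf{1}_{\mathbb{N}_{>0}}\to\mathbf{N}$ be the global size functor. Then the square formed by $\{\_\}:\mathcal{S}\mathbf{L}\to\mathbf{L}$, $!:\mathcal{S}\mathbf{L}\to\mathbf{1}_{\mathbb{N}_{>0}}$, $!:\mathbf{L}\to\mathbf{N}$ and $[\_]:\mathbf{1}_{\mathbb{N}_{>0}}\to\mathbf{N}$ is a pullback square: it commutes, $[\_]\circ{!}={!}\circ\{\_\}$, and for every pair of functors $f:\mathbf{K}\to\mathbf{1}_{\mathbb{N}_{>0}}$ and $g:\mathbf{K}\to\mathbf{L}$ with $[\_]\circ f={!}\circ g$ there is a unique functor $h:\mathbf{K}\to\mathcal{S}\mathbf{L}$ with $!\circ h=f$ and $\{\_\}\circ h=g$. (Here functors are symmetric monoidal functors between small symmetric monoidal categories.)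
   Context: Props. For a set $C$ of colors, $C^*$ is the set of finite lists of elements of $C$, $\boxtimes$ is concatenation and $0$ the empty list. A $C$-colored prop is a small symmetric strict monoidal category whose monoid of objects is $(C^*,\boxtimes,0)$; a $C$-colored prop morphism is an identity-on-objects symmetric strict monoidal functor. A $C$-colored signature $\Sigma$ is a family of sets $\Sigma[\mathbf{a},\mathbf{b}]$ ($\mathbf{a},\mathbf{b}\in C^*$) of generators of type $\mathbf{a}\to\mathbf{b}$; $F(\Sigma)$ is the free $C$-colored prop on $\Sigma$, and its morphisms are called diagrams. A $C$-colored graphical language $\mathcal{L}$ is a signature $\Sigma_\mathcal{L}$ together with a family of equations (pairs of parallel diagrams in $F(\Sigma_\mathcal{L})$); its underlying prop $\mathbf{L}$ is the quotient of $F(\Sigma_\mathcal{L})$ by the smallest prop congruence containing the equations, with quotient morphism $\pi_\mathcal{L}:F(\Sigma_\mathcal{L})\to\mathbf{L}$. Monochromatic means $C$ is a singleton; then objects are the natural numbers (lengths of lists). Sizes. Colors are now the positive integers $\mathbb{N}_{>0}$. The list consisting of $k$ copies of $n$ is denoted $k\cdot n$; so $1\cdot n$ is the one-element list $\langle n\rangle$ and $k\cdot 1$ is the list of $k$ ones; by convention $0\cdot n=k\cdot 0=0$. The global size of $\mathbf{a}=\langle n_1,\dots,n_k\rangle$ is $[\mathbf{a}]=n_1+\dots+n_k$. Scalable construction. Let $\mathcal{L}$ be a monochromatic graphical language. $\mathcal{SL}$ is the $\mathbb{N}_{>0}$-colored graphical language whose generators are: for each $n\ge 1$, a divider $\delta_n:1\cdot(n+1)\to(1\cdot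 1)\boxtimes(1\cdot n)$ and a gatherer $\gamma_n:(1\cdot 1)\boxtimes(1\cdot n)\to 1\cdot(n+1)$; and each generator $x\in\Sigma_\mathcal{L}[n,m]$, regarded as having type $n\cdot 1\to m\cdot 1$. Its equations are $\gamma_n\circ\delta_n=\mathrm{id}_{1\cdot(n+1)}$ and $\delta_n\circ\gamma_n=\mathrm{id}_{1\cdot 1}\boxtimes\mathrm{id}_{1\cdot n}$ for all $n\ge1$, together with the equations of $\mathcal{L}$ (read on wires of size 1). Its underlying prop is denoted $\mathcal{S}\mathbf{L}$. Wire stripper. $\{\_\}:\mathcal{S}\mathbf{L}\to\mathbf{L}$ is the symmetric strict monoidal functor with $\{\mathbf{a}\}=[\mathbf{a}]$ on objects, $\{\pi_\mathcal{SL}(\delta_k)\}=\{\pi_\mathcal{SL}(\gamma_k)\}=\mathrm{id}_{k+1}$, and $\{\pi_\mathcal{SL}(x)\}=\pi_\mathcal{L}(x)$ for $x\in\Sigma_\mathcal{L}$. Terminal props. $\mathbf{1}_{\mathbb{N}_{>0}}$ is the codiscrete category (exactly one morphism between any two objects) on $(\mathbb{N}_{>0})^*$, the terminal $\mathbb{N}_{>0}$-colored prop. $\mathbf{N}$ is the codiscrete category on $\mathbb{N}=\{0,1,2,\dots\}$, the terminal monochromatic prop. The global size functor $[\_]:\mathbf{1}_{\mathbb{N}_{>0}}\to\mathbf{N}$ is $\mathbf{a}\mapsto[\mathbf{a}]$ on objects. -}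

module Defs where

open import Algebra.Structures using (IsMonoid)
open import Data.Empty.Polymorphic using (⊥)
open import Data.Irrelevant using () renaming ([_] to irrelevant)
open import Data.List.Base using (List; []; _∷_; _++_; map; replicate)
open import Data.List.Properties using (++-isMonoid; map-++)
open import Data.Nat.Base using (ℕ; zero; suc; _+_; _<_; z≤n; s≤s)
open import Data.Nat.ListAction using (sum)
open import Data.Nat.ListAction.Properties using (sum-++)
open import Data.Nat.Properties using (+-0-isMonoid)
open import Data.Product.Base using (_×_)
open import Data.Product using (∃!)
open import Data.Refinement using (_,_; value; Refinement-syntax)
open import Data.Unit.Base using (⊤; tt)
open import Data.Unit.Polymorphic.Base renaming (⊤ to ⊤ₚ) using ()
open import Level using (Level; _⊔_; 0ℓ) renaming (suc to lsuc)
open import Relation.Binary.PropositionalEquality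
  using (_≡_; refl; sym; trans; cong; cong₂; subst; isEquivalence)
open import Relation.Binary.Structures using (IsEquivalence)

private
  variable
    o ℓ e o′ ℓ′ e′ o″ ℓ″ e″ s t : Level

-- A set of objects, compared by _≡_, and a setoid of morphisms between
-- any two objects.  Quotients of sets of morphisms are quotients of _≈_.

record Category (Obj : Set o) ℓ e : Set (o ⊔ lsuc (ℓ ⊔ e)) where
  infix  4 _≈_ _≋_
  infixr 9 _∘_
  field
    Hom      : Obj → Obj → Set ℓ
    _≈_      : ∀ {a b} → Hom a b → Hom a b → Set e
    ≈-equiv  : ∀ {a b} → IsEquivalence (_≈_ {a} {b})
    id       : ∀ {a} → Hom a a
    _∘_      : ∀ {a b c} → Hom b c → Hom a b → Hom a c
    ∘-resp-≈ : ∀ {a b c} {f f′ : Hom b c} {g g′ : Hom a b} →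
               f ≈ f′ → g ≈ g′ → f ∘ g ≈ f′ ∘ g′
    assoc    : ∀ {a b c d} {f : Hom c d} {g : Hom b c} {h : Hom a b} →
               (f ∘ g) ∘ h ≈ f ∘ (g ∘ h)
    idˡ      : ∀ {a b} {f : Hom a b} → id ∘ f ≈ f
    idʳ      : ∀ {a b} {f : Hom a b} → f ∘ id ≈ f

  module ≈ {a b} = IsEquivalence (≈-equiv {a} {b})

  extendʳ : ∀ {a b c b′ d} {f : Hom b c} {g : Hom a b} {h : Hom b′ c} {k : Hom a b′}
            {l : Hom d a} → f ∘ g ≈ h ∘ k → f ∘ g ∘ l ≈ h ∘ k ∘ l
  extendʳ p = ≈.trans (≈.sym assoc) (≈.trans (∘-resp-≈ p ≈.refl) assoc)

  -- The identity, read along an equality of objects.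
  coe : ∀ {a b} → a ≡ b → Hom a b
  coe {a} p = subst (Hom a) p id

  -- Equality of morphisms whose endpoints are equal, but not necessarily
  -- definitionally so.
  data _≋_ {a b} (f : Hom a b) : ∀ {c d} → Hom c d → Set (ℓ ⊔ e) where
    hetero : ∀ {g : Hom a b} → f ≈ g → f ≋ g

  ≋⇒≈ : ∀ {a b} {f g : Hom a b} → f ≋ g → f ≈ g
  ≋⇒≈ (hetero p) = p

  ≋-refl : ∀ {a b} {f : Hom a b} → f ≋ f
  ≋-refl = hetero ≈.refl

  ≋-sym : ∀ {a b c d} {f : Hom a b} {g : Hom c d} → f ≋ g → g ≋ f
  ≋-sym (hetero p) = hetero (≈.sym p)

  ≋-trans : ∀ {a b c d a′ b′} {f : Hom a b} {g : Hom c d} {h : Hom a′ b′} →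
            f ≋ g → g ≋ h → f ≋ h
  ≋-trans (hetero p) (hetero q) = hetero (≈.trans p q)

  ∘-resp-≋ : ∀ {a b c a′ b′ c′} {f : Hom b c} {g : Hom a b}
             {f′ : Hom b′ c′} {g′ : Hom a′ b′} →
             f ≋ f′ → g ≋ g′ → f ∘ g ≋ f′ ∘ g′
  ∘-resp-≋ (hetero p) (hetero q) = hetero (∘-resp-≈ p q)

  coe≋id : ∀ {a b} (p : a ≡ b) → coe p ≋ id {b}
  coe≋id refl = ≋-refl

  id-cong : ∀ {a b} → a ≡ b → id {a} ≋ id {b}
  id-cong refl = ≋-refl

  coe-∘ : ∀ {a b c} (p : b ≡ c) {f : Hom a b} → coe p ∘ f ≋ f
  coe-∘ refl = hetero idˡ

  ∘-coe : ∀ {a b c} (p : a ≡ b) {f : Hom b c} → f ∘ coe p ≋ f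
  ∘-coe refl = hetero idʳ

  conj≋ : ∀ {a b c d} (p : c ≡ d) (q : a ≡ b) {f : Hom b c} →
          coe p ∘ f ∘ coe q ≋ f
  conj≋ p q = ≋-trans (coe-∘ p) (∘-coe q)

  square⇒≋ : ∀ {a b c d} (p : a ≡ c) (q : b ≡ d) {f : Hom a b} {g : Hom c d} →
             coe q ∘ f ≈ g ∘ coe p → f ≋ g
  square⇒≋ p q r = ≋-trans (≋-sym (coe-∘ q)) (≋-trans (hetero r) (∘-coe p))

  ≋⇒square : ∀ {a b c d} (p : a ≡ c) (q : b ≡ d) {f : Hom a b} {g : Hom c d} →
             f ≋ g → coe q ∘ f ≈ g ∘ coe p
  ≋⇒square p q r = ≋⇒≈ (≋-trans (coe-∘ q) (≋-trans r (≋-sym (∘-coe p))))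

  ∘-id≋ : ∀ {a b c d} {f : Hom b c} {g : Hom a b} →
          f ≋ id {d} → g ≋ id {d} → f ∘ g ≋ id {d}
  ∘-id≋ p q = ≋-trans (∘-resp-≋ p q) (hetero idˡ)

  record Iso (a b : Obj) : Set (ℓ ⊔ e) where
    field
      to   : Hom a b
      from : Hom b a
      isoˡ : from ∘ to ≈ id
      isoʳ : to ∘ from ≈ id

  open Iso public

  infixr 9 _∘ᵢ_
  _∘ᵢ_ : ∀ {a b c} → Iso b c → Iso a b → Iso a c
  p ∘ᵢ q = record
    { to   = to p ∘ to q
    ; from = from q ∘ from p
    ; isoˡ = ≈.trans assoc (≈.trans (∘-resp-≈ ≈.refl (cancel (isoˡ p))) (isoˡ q))
    ; isoʳ = ≈.trans assoc (≈.trans (∘-resp-≈ ≈.refl (cancel (isoʳ q))) (isoʳ p))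
    }
    where
    cancel : ∀ {a b c} {f : Hom b c} {g : Hom c b} {h : Hom a c} →
             f ∘ g ≈ id → f ∘ g ∘ h ≈ h
    cancel p = ≈.trans (≈.sym assoc) (≈.trans (∘-resp-≈ p ≈.refl) idˡ)

  coe-iso : ∀ {a b} → a ≡ b → Iso a b
  coe-iso p = record
    { to   = coe p
    ; from = coe (sym p)
    ; isoˡ = ≋⇒≈ (≋-trans (coe-∘ (sym p)) (≋-trans (coe≋id p) (id-cong (sym p))))
    ; isoʳ = ≋⇒≈ (≋-trans (coe-∘ p) (≋-trans (coe≋id (sym p)) (id-cong p)))
    }

record SymmetricMonoidalCategory o ℓ e : Set (lsuc (o ⊔ ℓ ⊔ e)) where
  infixr 10 _⊗₀_ _⊗₁_
  field
    Obj      : Set o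
    category : Category Obj ℓ e

  open Category category public

  field
    unit : Obj
    _⊗₀_ : Obj → Obj → Obj
    _⊗₁_ : ∀ {a b c d} → Hom a b → Hom c d → Hom (a ⊗₀ c) (b ⊗₀ d)

    ⊗-resp-≈ : ∀ {a b c d} {f f′ : Hom a b} {g g′ : Hom c d} →
               f ≈ f′ → g ≈ g′ → f ⊗₁ g ≈ f′ ⊗₁ g′
    ⊗-id     : ∀ {a b} → id {a} ⊗₁ id {b} ≈ id
    ⊗-∘      : ∀ {a b c a′ b′ c′} {f : Hom b c} {g : Hom a b}
               {f′ : Hom b′ c′} {g′ : Hom a′ b′} →
               (f ∘ g) ⊗₁ (f′ ∘ g′) ≈ (f ⊗₁ f′) ∘ (g ⊗₁ g′)

    associator : ∀ a b c → Iso ((a ⊗₀ b) ⊗₀ c) (a ⊗₀ (b ⊗₀ c))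
    unitorˡ    : ∀ a → Iso (unit ⊗₀ a) a
    unitorʳ    : ∀ a → Iso (a ⊗₀ unit) a
    σ          : ∀ a b → Hom (a ⊗₀ b) (b ⊗₀ a)

  α : ∀ a b c → Hom ((a ⊗₀ b) ⊗₀ c) (a ⊗₀ (b ⊗₀ c))
  α a b c = to (associator a b c)

  λ⇒ : ∀ a → Hom (unit ⊗₀ a) a
  λ⇒ a = to (unitorˡ a)

  ρ⇒ : ∀ a → Hom (a ⊗₀ unit) a
  ρ⇒ a = to (unitorʳ a)

  field
    α-natural : ∀ {a a′ b b′ c c′} {f : Hom a a′} {g : Hom b b′} {h : Hom c c′} →
                α a′ b′ c′ ∘ ((f ⊗₁ g) ⊗₁ h) ≈ (f ⊗₁ (g ⊗₁ h)) ∘ α a b c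
    λ-natural : ∀ {a b} {f : Hom a b} → λ⇒ b ∘ (id ⊗₁ f) ≈ f ∘ λ⇒ a
    ρ-natural : ∀ {a b} {f : Hom a b} → ρ⇒ b ∘ (f ⊗₁ id) ≈ f ∘ ρ⇒ a
    σ-natural : ∀ {a a′ b b′} {f : Hom a a′} {g : Hom b b′} →
                σ a′ b′ ∘ (f ⊗₁ g) ≈ (g ⊗₁ f) ∘ σ a b
    triangle  : ∀ {a b} → (id ⊗₁ λ⇒ b) ∘ α a unit b ≈ ρ⇒ a ⊗₁ id
    pentagon  : ∀ {a b c d} →
                (id ⊗₁ α b c d) ∘ α a (b ⊗₀ c) d ∘ (α a b c ⊗₁ id)
                ≈ α a b (c ⊗₀ d) ∘ α (a ⊗₀ b) c d
    σ-σ       : ∀ {a b} → σ b a ∘ σ a b ≈ id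
    hexagon   : ∀ {a b c} →
                (id ⊗₁ σ a c) ∘ α b a c ∘ (σ a b ⊗₁ id)
                ≈ α b c a ∘ σ a (b ⊗₀ c) ∘ α a b c

record SymmetricMonoidalFunctor
  (A : SymmetricMonoidalCategory o ℓ e) (B : SymmetricMonoidalCategory o′ ℓ′ e′)
  : Set (o ⊔ ℓ ⊔ e ⊔ o′ ⊔ ℓ′ ⊔ e′) where
  private
    module A = SymmetricMonoidalCategory A
    module B = SymmetricMonoidalCategory B
  open B using (_∘_; _≈_; _⊗₁_; to)
  field
    F₀        : A.Obj → B.Obj
    F₁        : ∀ {a b} → A.Hom a b → B.Hom (F₀ a) (F₀ b)
    F-resp-≈  : ∀ {a b} {f g : A.Hom a b} → f A.≈ g → F₁ f ≈ F₁ g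
    F-id      : ∀ {a} → F₁ (A.id {a}) ≈ B.id
    F-∘       : ∀ {a b c} {f : A.Hom b c} {g : A.Hom a b} →
                F₁ (f A.∘ g) ≈ F₁ f ∘ F₁ g
    ε-iso     : B.Iso B.unit (F₀ A.unit)
    μ-iso     : ∀ a b → B.Iso (F₀ a B.⊗₀ F₀ b) (F₀ (a A.⊗₀ b))

  ε : B.Hom B.unit (F₀ A.unit)
  ε = to ε-iso

  μ : ∀ a b → B.Hom (F₀ a B.⊗₀ F₀ b) (F₀ (a A.⊗₀ b))
  μ a b = to (μ-iso a b)

  field
    μ-natural : ∀ {a a′ b b′} {f : A.Hom a a′} {g : A.Hom b b′} →
                μ a′ b′ ∘ (F₁ f ⊗₁ F₁ g) ≈ F₁ (f A.⊗₁ g) ∘ μ a b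
    μ-assoc   : ∀ {a b c} →
                F₁ (A.α a b c) ∘ μ (a A.⊗₀ b) c ∘ (μ a b ⊗₁ B.id)
                ≈ μ a (b A.⊗₀ c) ∘ (B.id ⊗₁ μ b c) ∘ B.α (F₀ a) (F₀ b) (F₀ c)
    μ-unitˡ   : ∀ {a} → F₁ (A.λ⇒ a) ∘ μ A.unit a ∘ (ε ⊗₁ B.id) ≈ B.λ⇒ (F₀ a)
    μ-unitʳ   : ∀ {a} → F₁ (A.ρ⇒ a) ∘ μ a A.unit ∘ (B.id ⊗₁ ε) ≈ B.ρ⇒ (F₀ a)
    μ-σ       : ∀ {a b} → F₁ (A.σ a b) ∘ μ a b ≈ μ b a ∘ B.σ (F₀ a) (F₀ b)

  F-resp-square : ∀ {a b b′ c} {f : A.Hom b c} {g : A.Hom a b}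
                  {h : A.Hom b′ c} {k : A.Hom a b′} →
                  f A.∘ g A.≈ h A.∘ k → F₁ f ∘ F₁ g ≈ F₁ h ∘ F₁ k
  F-resp-square p = B.≈.trans (B.≈.sym F-∘) (B.≈.trans (F-resp-≈ p) F-∘)

  F-∘₃ : ∀ {a b c d} {x} {f : A.Hom c d} {g : A.Hom b c} {h : A.Hom a b}
         {k : B.Hom x (F₀ a)} →
         F₁ (f A.∘ g A.∘ h) ∘ k ≈ F₁ f ∘ F₁ g ∘ F₁ h ∘ k
  F-∘₃ = B.≈.trans
    (B.∘-resp-≈ (B.≈.trans F-∘ (B.∘-resp-≈ B.≈.refl F-∘)) B.≈.refl)
    (B.≈.trans B.assoc (B.∘-resp-≈ B.≈.refl B.assoc))

  μ-whiskerʳ : ∀ {a a′ b x} {f : A.Hom a a′} {k : B.Hom x (F₀ a)} →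
               μ a′ b ∘ ((F₁ f ∘ k) ⊗₁ B.id) ≈ F₁ (f A.⊗₁ A.id) ∘ μ a b ∘ (k ⊗₁ B.id)
  μ-whiskerʳ = B.≈.trans
    (B.∘-resp-≈ B.≈.refl (B.≈.trans
      (B.⊗-resp-≈ B.≈.refl (B.≈.trans (B.≈.sym B.idˡ) (B.∘-resp-≈ (B.≈.sym F-id) B.≈.refl)))
      B.⊗-∘))
    (B.extendʳ μ-natural)

  μ-whiskerˡ : ∀ {a a′ b x} {f : A.Hom a a′} {k : B.Hom x (F₀ a)} →
               μ b a′ ∘ (B.id ⊗₁ (F₁ f ∘ k)) ≈ F₁ (A.id A.⊗₁ f) ∘ μ b a ∘ (B.id ⊗₁ k)
  μ-whiskerˡ = B.≈.trans
    (B.∘-resp-≈ B.≈.refl (B.≈.trans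
      (B.⊗-resp-≈ (B.≈.trans (B.≈.sym B.idˡ) (B.∘-resp-≈ (B.≈.sym F-id) B.≈.refl)) B.≈.refl)
      B.⊗-∘))
    (B.extendʳ μ-natural)

module _ {A : SymmetricMonoidalCategory o ℓ e}
         {B : SymmetricMonoidalCategory o′ ℓ′ e′} where
  private
    module A = SymmetricMonoidalCategory A
    module B = SymmetricMonoidalCategory B

  record IsStrict (F : SymmetricMonoidalFunctor A B)
    : Set (o ⊔ ℓ′ ⊔ e′) where
    open SymmetricMonoidalFunctor F
    field
      ε-strict : ε B.≋ B.id {F₀ A.unit}
      μ-strict : ∀ a b → μ a b B.≋ B.id {F₀ (a A.⊗₀ b)}

  -- Equality, not isomorphism, of symmetric monoidal functors.
  infix 4 _≃_
  record _≃_ (F G : SymmetricMonoidalFunctor A B)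
    : Set (o ⊔ ℓ ⊔ o′ ⊔ ℓ′ ⊔ e′) where
    private
      module F = SymmetricMonoidalFunctor F
      module G = SymmetricMonoidalFunctor G
    field
      F₀-≡ : ∀ a → F.F₀ a ≡ G.F₀ a
      F₁-≋ : ∀ {a b} (f : A.Hom a b) → F.F₁ f B.≋ G.F₁ f
      ε-≋  : F.ε B.≋ G.ε
      μ-≋  : ∀ a b → F.μ a b B.≋ G.μ a b

module _ {A : SymmetricMonoidalCategory o ℓ e}
         {B : SymmetricMonoidalCategory o′ ℓ′ e′}
         {C : SymmetricMonoidalCategory o″ ℓ″ e″} where
  private
    module A = SymmetricMonoidalCategory A
    module B = SymmetricMonoidalCategory B
    module C = SymmetricMonoidalCategory C

  infixr 9 _∘F_
  _∘F_ : SymmetricMonoidalFunctor B C → SymmetricMonoidalFunctor A B →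
         SymmetricMonoidalFunctor A C
  G ∘F F = record
    { F₀        = λ a → G.F₀ (F.F₀ a)
    ; F₁        = λ f → G.F₁ (F.F₁ f)
    ; F-resp-≈  = λ p → G.F-resp-≈ (F.F-resp-≈ p)
    ; F-id      = G.F-resp-≈ F.F-id ⟫ G.F-id
    ; F-∘       = G.F-resp-≈ F.F-∘ ⟫ G.F-∘
    ; ε-iso     = mapIso F.ε-iso C.∘ᵢ G.ε-iso
    ; μ-iso     = λ a b → mapIso (F.μ-iso a b) C.∘ᵢ G.μ-iso (F.F₀ a) (F.F₀ b)
    ; μ-natural = C.assoc ⟫ under G.μ-natural ⟫
                  C.extendʳ (G.F-resp-square F.μ-natural)
    ; μ-assoc   = under (C.assoc ⟫ under G.μ-whiskerʳ) ⟫ sym≈ G.F-∘₃ ⟫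
                  C.∘-resp-≈ (G.F-resp-≈ F.μ-assoc) refl≈ ⟫ G.F-∘₃ ⟫
                  under (under G.μ-assoc ⟫ under (sym≈ C.assoc) ⟫ sym≈ C.assoc ⟫
                         C.∘-resp-≈ (sym≈ G.μ-whiskerˡ) refl≈ ⟫ C.assoc) ⟫
                  sym≈ C.assoc
    ; μ-unitˡ   = under (C.assoc ⟫ under G.μ-whiskerʳ) ⟫ sym≈ G.F-∘₃ ⟫
                  C.∘-resp-≈ (G.F-resp-≈ F.μ-unitˡ) refl≈ ⟫ G.μ-unitˡ
    ; μ-unitʳ   = under (C.assoc ⟫ under G.μ-whiskerˡ) ⟫ sym≈ G.F-∘₃ ⟫
                  C.∘-resp-≈ (G.F-resp-≈ F.μ-unitʳ) refl≈ ⟫ G.μ-unitʳ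
    ; μ-σ       = C.extendʳ (G.F-resp-square F.μ-σ) ⟫ under G.μ-σ ⟫ sym≈ C.assoc
    }
    where
    module F = SymmetricMonoidalFunctor F
    module G = SymmetricMonoidalFunctor G

    infixr 5 _⟫_
    _⟫_ : ∀ {a b} {f g h : C.Hom a b} → f C.≈ g → g C.≈ h → f C.≈ h
    _⟫_ = C.≈.trans

    refl≈ : ∀ {a b} {f : C.Hom a b} → f C.≈ f
    refl≈ = C.≈.refl

    sym≈ : ∀ {a b} {f g : C.Hom a b} → f C.≈ g → g C.≈ f
    sym≈ = C.≈.sym

    under : ∀ {a b c} {f : C.Hom b c} {g h : C.Hom a b} →
            g C.≈ h → f C.∘ g C.≈ f C.∘ h
    under = C.∘-resp-≈ refl≈

    mapIso : ∀ {a b} → B.Iso a b → C.Iso (G.F₀ a) (G.F₀ b)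
    mapIso p = record
      { to   = G.F₁ (B.to p)
      ; from = G.F₁ (B.from p)
      ; isoˡ = sym≈ G.F-∘ ⟫ G.F-resp-≈ (B.isoˡ p) ⟫ G.F-id
      ; isoʳ = sym≈ G.F-∘ ⟫ G.F-resp-≈ (B.isoʳ p) ⟫ G.F-id
      }

-- "Symmetric monoidal functor" may be read with invertible or with
-- identity structure morphisms; each reading gives a category of small
-- symmetric monoidal categories.
data FunctorKind : Set where
  strong strict : FunctorKind

OfKind : FunctorKind → {A : SymmetricMonoidalCategory o ℓ e}
         {B : SymmetricMonoidalCategory o′ ℓ′ e′} →
         SymmetricMonoidalFunctor A B → Set (o ⊔ ℓ′ ⊔ e′)
OfKind strong F = ⊤ₚ
OfKind strict F = IsStrict F

-- The square
--
--        q
--     P ───→ B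
--   p │      │ g
--     ↓      ↓
--     A ───→ C
--        f
--
-- tested against categories K of levels o, ℓ and e.
module _ {oP ℓP eP oA ℓA eA oB ℓB eB oC ℓC eC : Level}
         {P : SymmetricMonoidalCategory oP ℓP eP}
         {A : SymmetricMonoidalCategory oA ℓA eA}
         {B : SymmetricMonoidalCategory oB ℓB eB}
         {C : SymmetricMonoidalCategory oC ℓC eC} where

  record IsPullback (κ : FunctorKind) (o ℓ e : Level)
    (p : SymmetricMonoidalFunctor P A) (q : SymmetricMonoidalFunctor P B)
    (f : SymmetricMonoidalFunctor A C) (g : SymmetricMonoidalFunctor B C)
    : Set (lsuc (o ⊔ ℓ ⊔ e) ⊔ oP ⊔ ℓP ⊔ eP ⊔ oA ⊔ ℓA ⊔ eA ⊔ oB ⊔ ℓB ⊔ eB ⊔ oC ⊔ ℓC ⊔ eC) where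
    field
      commutes  : f ∘F p ≃ g ∘F q
      universal : {K : SymmetricMonoidalCategory o ℓ e}
                  (u : SymmetricMonoidalFunctor K A) (v : SymmetricMonoidalFunctor K B) →
                  OfKind κ u → OfKind κ v → f ∘F u ≃ g ∘F v →
                  ∃! _≃_ λ (h : SymmetricMonoidalFunctor K P) →
                    OfKind κ h × (p ∘F h ≃ u) × (q ∘F h ≃ v)

record ObjectMonoid o : Set (lsuc o) where
  infixr 10 _∙_
  field
    Carrier  : Set o
    _∙_      : Carrier → Carrier → Carrier
    ε        : Carrier
    isMonoid : IsMonoid _≡_ _∙_ ε
  open IsMonoid isMonoid public
    using () renaming (assoc to ∙-assoc; identityˡ to ∙-idˡ; identityʳ to ∙-idʳ)

record ObjectHom (M : ObjectMonoid o) (N : ObjectMonoid o′) : Set (o ⊔ o′) where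
  private
    module M = ObjectMonoid M
    module N = ObjectMonoid N
  field
    ⟦_⟧₀   : M.Carrier → N.Carrier
    ∙-homo : ∀ a b → ⟦ a M.∙ b ⟧₀ ≡ ⟦ a ⟧₀ N.∙ ⟦ b ⟧₀
    ε-homo : ⟦ M.ε ⟧₀ ≡ N.ε

record StrictSMC (M : ObjectMonoid o) ℓ e : Set (o ⊔ lsuc (ℓ ⊔ e)) where
  open ObjectMonoid M
  infixr 10 _⊗_
  field
    category : Category Carrier ℓ e

  open Category category public

  field
    _⊗_       : ∀ {a b c d} → Hom a b → Hom c d → Hom (a ∙ c) (b ∙ d)
    σ         : ∀ a b → Hom (a ∙ b) (b ∙ a)
    ⊗-resp-≈  : ∀ {a b c d} {f f′ : Hom a b} {g g′ : Hom c d} →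
                f ≈ f′ → g ≈ g′ → f ⊗ g ≈ f′ ⊗ g′
    ⊗-id      : ∀ {a b} → id {a} ⊗ id {b} ≈ id
    ⊗-∘       : ∀ {a b c a′ b′ c′} {f : Hom b c} {g : Hom a b}
                {f′ : Hom b′ c′} {g′ : Hom a′ b′} →
                (f ∘ g) ⊗ (f′ ∘ g′) ≈ (f ⊗ f′) ∘ (g ⊗ g′)
    ⊗-assoc   : ∀ {a a′ b b′ c c′} {f : Hom a a′} {g : Hom b b′} {h : Hom c c′} →
                (f ⊗ g) ⊗ h ≋ f ⊗ (g ⊗ h)
    ⊗-idˡ     : ∀ {a b} {f : Hom a b} → id {ε} ⊗ f ≋ f
    ⊗-idʳ     : ∀ {a b} {f : Hom a b} → f ⊗ id {ε} ≋ f
    σ-natural : ∀ {a a′ b b′} {f : Hom a a′} {g : Hom b b′} →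
                σ a′ b′ ∘ (f ⊗ g) ≈ (g ⊗ f) ∘ σ a b
    σ-σ       : ∀ {a b} → σ b a ∘ σ a b ≈ id
    hexagon   : ∀ {a b c} →
                (id ⊗ σ a c) ∘ coe (∙-assoc b a c) ∘ (σ a b ⊗ id) ≋ σ a (b ∙ c)

  ⊗-resp-≋ : ∀ {a b c d a′ b′ c′ d′} {f : Hom a b} {g : Hom c d}
             {f′ : Hom a′ b′} {g′ : Hom c′ d′} →
             f ≋ f′ → g ≋ g′ → f ⊗ g ≋ f′ ⊗ g′
  ⊗-resp-≋ (hetero p) (hetero q) = hetero (⊗-resp-≈ p q)

  ⊗-id≋ : ∀ {a b c d a′ b′} {f : Hom a b} {g : Hom c d} →
          f ≋ id {a′} → g ≋ id {b′} → f ⊗ g ≋ id {a′ ∙ b′}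
  ⊗-id≋ p q = ≋-trans (⊗-resp-≋ p q) (hetero ⊗-id)

  σ-cong : ∀ {a a′ b b′} → a ≡ a′ → b ≡ b′ → σ a b ≋ σ a′ b′
  σ-cong refl refl = ≋-refl

  symmetricMonoidalCategory : SymmetricMonoidalCategory _ ℓ e
  symmetricMonoidalCategory = record
    { Obj        = Carrier
    ; category   = category
    ; unit       = ε
    ; _⊗₀_       = _∙_
    ; _⊗₁_       = _⊗_
    ; ⊗-resp-≈   = ⊗-resp-≈
    ; ⊗-id       = ⊗-id
    ; ⊗-∘        = ⊗-∘
    ; associator = λ a b c → coe-iso (∙-assoc a b c)
    ; unitorˡ    = λ a → coe-iso (∙-idˡ a)
    ; unitorʳ    = λ a → coe-iso (∙-idʳ a)
    ; σ          = σ
    ; α-natural  = ≋⇒square (∙-assoc _ _ _) (∙-assoc _ _ _) ⊗-assoc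
    ; λ-natural  = ≋⇒square (∙-idˡ _) (∙-idˡ _) ⊗-idˡ
    ; ρ-natural  = ≋⇒square (∙-idʳ _) (∙-idʳ _) ⊗-idʳ
    ; σ-natural  = σ-natural
    ; triangle   = ≋⇒≈ (≋-trans
        (∘-id≋ (⊗-id≋ ≋-refl (coe≋id (∙-idˡ _))) (coe-end (∙-assoc _ _ _) (cong₂ _∙_ refl (∙-idˡ _))))
        (≋-sym (⊗-id≋ (coe≋id (∙-idʳ _)) ≋-refl)))
    ; pentagon   = ≋⇒≈ (≋-trans
        (∘-id≋ (⊗-id≋ ≋-refl (coe≋id (∙-assoc _ _ _)))
          (∘-id≋ (coe-end (∙-assoc _ _ _) (cong₂ _∙_ refl (∙-assoc _ _ _)))
            (≋-trans (⊗-id≋ (coe≋id (∙-assoc _ _ _)) ≋-refl)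
              (id-cong (trans (∙-assoc _ _ _) (cong₂ _∙_ refl (∙-assoc _ _ _)))))))
        (≋-sym (∘-id≋ (coe≋id (∙-assoc _ _ _)) (coe-end (∙-assoc _ _ _) (∙-assoc _ _ _)))))
    ; σ-σ        = σ-σ
    ; hexagon    = ≋⇒≈ (≋-trans hexagon (≋-sym (conj≋ (∙-assoc _ _ _) (∙-assoc _ _ _))))
    }
    where
    coe-end : ∀ {a b c} (p : a ≡ b) (q : b ≡ c) → coe p ≋ id {c}
    coe-end p q = ≋-trans (coe≋id p) (id-cong q)

-- Not required to be the identity on objects.
record StrictFunctor {M : ObjectMonoid o} {N : ObjectMonoid o′}
  (P : StrictSMC M ℓ e) (Q : StrictSMC N ℓ′ e′)
  : Set (o ⊔ ℓ ⊔ e ⊔ o′ ⊔ ℓ′ ⊔ e′) where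
  private
    module M = ObjectMonoid M
    module N = ObjectMonoid N
    module P = StrictSMC P
    module Q = StrictSMC Q
  field
    objects : ObjectHom M N
  open ObjectHom objects
  field
    F₁       : ∀ {a b} → P.Hom a b → Q.Hom ⟦ a ⟧₀ ⟦ b ⟧₀
    F-resp-≈ : ∀ {a b} {f g : P.Hom a b} → f P.≈ g → F₁ f Q.≈ F₁ g
    F-id     : ∀ {a} → F₁ (P.id {a}) Q.≈ Q.id
    F-∘      : ∀ {a b c} {f : P.Hom b c} {g : P.Hom a b} →
               F₁ (f P.∘ g) Q.≈ F₁ f Q.∘ F₁ g
    F-⊗      : ∀ {a b c d} {f : P.Hom a b} {g : P.Hom c d} →
               F₁ (f P.⊗ g) Q.≋ F₁ f Q.⊗ F₁ g
    F-σ      : ∀ {a b} → F₁ (P.σ a b) Q.≋ Q.σ ⟦ a ⟧₀ ⟦ b ⟧₀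

  F-coe : ∀ {a b} (p : a ≡ b) → F₁ (P.coe p) Q.≋ Q.id {⟦ b ⟧₀}
  F-coe refl = Q.hetero F-id

  private
    μ-≡ : ∀ a b → ⟦ a ⟧₀ N.∙ ⟦ b ⟧₀ ≡ ⟦ a M.∙ b ⟧₀
    μ-≡ a b = sym (∙-homo a b)

    ε-≡ : N.ε ≡ ⟦ M.ε ⟧₀
    ε-≡ = sym ε-homo

    coe-end : ∀ {a b c} (p : a ≡ b) (q : b ≡ c) → Q.coe p Q.≋ Q.id {c}
    coe-end p q = Q.≋-trans (Q.coe≋id p) (Q.id-cong q)

  symmetricMonoidalFunctor : SymmetricMonoidalFunctor
    P.symmetricMonoidalCategory Q.symmetricMonoidalCategory
  symmetricMonoidalFunctor = record
    { F₀        = ⟦_⟧₀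
    ; F₁        = F₁
    ; F-resp-≈  = F-resp-≈
    ; F-id      = F-id
    ; F-∘       = F-∘
    ; ε-iso     = Q.coe-iso ε-≡
    ; μ-iso     = λ a b → Q.coe-iso (μ-≡ a b)
    ; μ-natural = Q.≋⇒square (μ-≡ _ _) (μ-≡ _ _) (Q.≋-sym F-⊗)
    ; μ-assoc   = λ {a} {b} {c} → Q.≋⇒≈ (Q.≋-trans
        (Q.∘-id≋ (F-coe (M.∙-assoc a b c))
          (Q.∘-id≋ (coe-end (μ-≡ (a M.∙ b) c) (cong ⟦_⟧₀ (M.∙-assoc a b c)))
            (Q.≋-trans (Q.⊗-id≋ (Q.coe≋id (μ-≡ a b)) Q.≋-refl)
              (Q.id-cong (trans (μ-≡ (a M.∙ b) c) (cong ⟦_⟧₀ (M.∙-assoc a b c)))))))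
        (Q.≋-sym (Q.∘-id≋ (Q.coe≋id (μ-≡ a (b M.∙ c)))
          (Q.∘-id≋
            (Q.≋-trans (Q.⊗-id≋ Q.≋-refl (Q.coe≋id (μ-≡ b c))) (Q.id-cong (μ-≡ a (b M.∙ c))))
            (coe-end (N.∙-assoc _ _ _)
              (trans (cong₂ N._∙_ refl (μ-≡ b c)) (μ-≡ a (b M.∙ c))))))))
    ; μ-unitˡ   = λ {a} → Q.≋⇒≈ (Q.≋-trans
        (Q.∘-id≋ (F-coe (M.∙-idˡ a))
          (Q.∘-id≋ (coe-end (μ-≡ M.ε a) (cong ⟦_⟧₀ (M.∙-idˡ a)))
            (Q.≋-trans (Q.⊗-id≋ (Q.coe≋id ε-≡) Q.≋-refl)
              (Q.id-cong (trans (μ-≡ M.ε a) (cong ⟦_⟧₀ (M.∙-idˡ a)))))))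
        (Q.≋-sym (Q.coe≋id (N.∙-idˡ _))))
    ; μ-unitʳ   = λ {a} → Q.≋⇒≈ (Q.≋-trans
        (Q.∘-id≋ (F-coe (M.∙-idʳ a))
          (Q.∘-id≋ (coe-end (μ-≡ a M.ε) (cong ⟦_⟧₀ (M.∙-idʳ a)))
            (Q.≋-trans (Q.⊗-id≋ Q.≋-refl (Q.coe≋id ε-≡))
              (Q.id-cong (trans (μ-≡ a M.ε) (cong ⟦_⟧₀ (M.∙-idʳ a)))))))
        (Q.≋-sym (Q.coe≋id (N.∙-idʳ _))))
    ; μ-σ       = Q.≋⇒≈ (Q.≋-trans (Q.∘-coe (μ-≡ _ _))
        (Q.≋-trans F-σ (Q.≋-sym (Q.coe-∘ (μ-≡ _ _)))))
    }

  isStrict : IsStrict symmetricMonoidalFunctor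
  isStrict = record
    { ε-strict = Q.coe≋id ε-≡
    ; μ-strict = λ a b → Q.coe≋id (μ-≡ a b)
    }

id-objects : {M : ObjectMonoid o} → ObjectHom M M
id-objects = record { ⟦_⟧₀ = λ a → a ; ∙-homo = λ _ _ → refl ; ε-homo = refl }

codiscrete : (M : ObjectMonoid o) → StrictSMC M 0ℓ 0ℓ
codiscrete M = record
  { category  = cat
  ; _⊗_       = λ _ _ → tt
  ; σ         = λ _ _ → tt
  ; ⊗-resp-≈  = λ _ _ → refl
  ; ⊗-id      = refl
  ; ⊗-∘       = refl
  ; ⊗-assoc   = λ {a} {a′} {b} {b′} {c} {c′} → parallel (∙-assoc a b c) (∙-assoc a′ b′ c′)
  ; ⊗-idˡ     = λ {a} {b} → parallel (∙-idˡ a) (∙-idˡ b)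
  ; ⊗-idʳ     = λ {a} {b} → parallel (∙-idʳ a) (∙-idʳ b)
  ; σ-natural = refl
  ; σ-σ       = refl
  ; hexagon   = λ {a} {b} {c} → parallel (∙-assoc a b c) (sym (∙-assoc b c a))
  }
  where
  open ObjectMonoid M
  cat : Category Carrier 0ℓ 0ℓ
  cat = record
    { Hom      = λ _ _ → ⊤
    ; _≈_      = _≡_
    ; ≈-equiv  = isEquivalence
    ; id       = tt
    ; _∘_      = λ _ _ → tt
    ; ∘-resp-≈ = λ _ _ → refl
    ; assoc    = refl
    ; idˡ      = refl
    ; idʳ      = refl
    }
  open Category cat using (_≋_; ≋-refl)

  parallel : ∀ {a b c d} → a ≡ c → b ≡ d → _≋_ {a} {b} tt {c} {d} tt
  parallel refl refl = ≋-refl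

-- Every functor into a codiscrete category is determined by its action
-- on objects.
into-codiscrete : {M : ObjectMonoid o} {N : ObjectMonoid o′} (P : StrictSMC M ℓ e) →
                  ObjectHom M N → StrictFunctor P (codiscrete N)
into-codiscrete {N = N} P h = record
  { objects  = h
  ; F₁       = λ _ → tt
  ; F-resp-≈ = λ _ → refl
  ; F-id     = refl
  ; F-∘      = refl
  ; F-⊗      = λ {a} {b} {c} {d} → parallel (∙-homo a c) (∙-homo b d)
  ; F-σ      = λ {a} {b} → parallel (∙-homo a b) (∙-homo b a)
  }
  where
  open ObjectHom h
  open StrictSMC (codiscrete N) using (_≋_; ≋-refl)

  parallel : ∀ {a b c d} → a ≡ c → b ≡ d → _≋_ {a} {b} tt {c} {d} tt
  parallel refl refl = ≋-refl

! : {M : ObjectMonoid o} (P : StrictSMC M ℓ e) → StrictFunctor P (codiscrete M)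
! P = into-codiscrete P id-objects

record Signature (M : ObjectMonoid o) s : Set (o ⊔ lsuc s) where
  open ObjectMonoid M
  field
    _[_,_] : Carrier → Carrier → Set s

open Signature public

module _ {M : ObjectMonoid o} where
  open ObjectMonoid M

  infixr 9  _∘ᵈ_
  infixr 10 _⊗ᵈ_
  -- Terms for the morphisms of the free prop; F(Σ) is their quotient by
  -- the prop axioms.
  data Diagram (Σ : Signature M s) : Carrier → Carrier → Set (o ⊔ s) where
    gen  : ∀ {a b} → Σ [ a , b ] → Diagram Σ a b
    idᵈ  : ∀ {a} → Diagram Σ a a
    _∘ᵈ_ : ∀ {a b c} → Diagram Σ b c → Diagram Σ a b → Diagram Σ a c
    _⊗ᵈ_ : ∀ {a b c d} → Diagram Σ a b → Diagram Σ c d → Diagram Σ (a ∙ c) (b ∙ d)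
    σᵈ   : ∀ a b → Diagram Σ (a ∙ b) (b ∙ a)

  coeᵈ : {Σ : Signature M s} → ∀ {a b} → a ≡ b → Diagram Σ a b
  coeᵈ {Σ = Σ} {a} p = subst (Diagram Σ a) p idᵈ

  Equations : Signature M s → ∀ t → Set (o ⊔ s ⊔ lsuc t)
  Equations Σ t = ∀ {a b} → Diagram Σ a b → Diagram Σ a b → Set t

  infix 4 _⊢_≈_
  -- The smallest prop congruence containing E, together with the prop
  -- axioms themselves.
  data _⊢_≈_ {Σ : Signature M s} (E : Equations Σ t) :
    ∀ {a b} → Diagram Σ a b → Diagram Σ a b → Set (o ⊔ s ⊔ t) where
    equation  : ∀ {a b} {f g : Diagram Σ a b} → E f g → E ⊢ f ≈ g

    ≈-refl    : ∀ {a b} {f : Diagram Σ a b} → E ⊢ f ≈ f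
    ≈-sym     : ∀ {a b} {f g : Diagram Σ a b} → E ⊢ f ≈ g → E ⊢ g ≈ f
    ≈-trans   : ∀ {a b} {f g h : Diagram Σ a b} → E ⊢ f ≈ g → E ⊢ g ≈ h → E ⊢ f ≈ h
    ∘-cong    : ∀ {a b c} {f f′ : Diagram Σ b c} {g g′ : Diagram Σ a b} →
                E ⊢ f ≈ f′ → E ⊢ g ≈ g′ → E ⊢ f ∘ᵈ g ≈ f′ ∘ᵈ g′
    ⊗-cong    : ∀ {a b c d} {f f′ : Diagram Σ a b} {g g′ : Diagram Σ c d} →
                E ⊢ f ≈ f′ → E ⊢ g ≈ g′ → E ⊢ f ⊗ᵈ g ≈ f′ ⊗ᵈ g′

    ∘-assoc   : ∀ {a b c d} {f : Diagram Σ c d} {g : Diagram Σ b c} {h : Diagram Σ a b} →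
                E ⊢ (f ∘ᵈ g) ∘ᵈ h ≈ f ∘ᵈ (g ∘ᵈ h)
    ∘-idˡ     : ∀ {a b} {f : Diagram Σ a b} → E ⊢ idᵈ ∘ᵈ f ≈ f
    ∘-idʳ     : ∀ {a b} {f : Diagram Σ a b} → E ⊢ f ∘ᵈ idᵈ ≈ f
    ⊗-id      : ∀ {a b} → E ⊢ idᵈ {a = a} ⊗ᵈ idᵈ {a = b} ≈ idᵈ
    ⊗-∘       : ∀ {a b c a′ b′ c′} {f : Diagram Σ b c} {g : Diagram Σ a b}
                {f′ : Diagram Σ b′ c′} {g′ : Diagram Σ a′ b′} →
                E ⊢ (f ∘ᵈ g) ⊗ᵈ (f′ ∘ᵈ g′) ≈ (f ⊗ᵈ f′) ∘ᵈ (g ⊗ᵈ g′)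
    ⊗-assoc   : ∀ {a a′ b b′ c c′}
                {f : Diagram Σ a a′} {g : Diagram Σ b b′} {h : Diagram Σ c c′} →
                E ⊢ coeᵈ (∙-assoc a′ b′ c′) ∘ᵈ ((f ⊗ᵈ g) ⊗ᵈ h)
                  ≈ (f ⊗ᵈ (g ⊗ᵈ h)) ∘ᵈ coeᵈ (∙-assoc a b c)
    ⊗-idˡ     : ∀ {a b} {f : Diagram Σ a b} →
                E ⊢ coeᵈ (∙-idˡ b) ∘ᵈ (idᵈ {a = ε} ⊗ᵈ f) ≈ f ∘ᵈ coeᵈ (∙-idˡ a)
    ⊗-idʳ     : ∀ {a b} {f : Diagram Σ a b} →
                E ⊢ coeᵈ (∙-idʳ b) ∘ᵈ (f ⊗ᵈ idᵈ {a = ε}) ≈ f ∘ᵈ coeᵈ (∙-idʳ a)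
    σ-natural : ∀ {a a′ b b′} {f : Diagram Σ a a′} {g : Diagram Σ b b′} →
                E ⊢ σᵈ a′ b′ ∘ᵈ (f ⊗ᵈ g) ≈ (g ⊗ᵈ f) ∘ᵈ σᵈ a b
    σ-σ       : ∀ {a b} → E ⊢ σᵈ b a ∘ᵈ σᵈ a b ≈ idᵈ
    hexagon   : ∀ {a b c} →
                E ⊢ (idᵈ ⊗ᵈ σᵈ a c) ∘ᵈ coeᵈ (∙-assoc b a c) ∘ᵈ (σᵈ a b ⊗ᵈ idᵈ)
                  ≈ coeᵈ (∙-assoc b c a) ∘ᵈ σᵈ a (b ∙ c) ∘ᵈ coeᵈ (∙-assoc a b c)

record GraphicalLanguage (M : ObjectMonoid o) s t : Set (o ⊔ lsuc (s ⊔ t)) where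
  field
    signature : Signature M s
    Equation  : Equations signature t

module _ {M : ObjectMonoid o} where
  open GraphicalLanguage

  underlying : (𝓛 : GraphicalLanguage M s t) → StrictSMC M _ _
  underlying 𝓛 = record
    { category  = cat
    ; _⊗_       = _⊗ᵈ_
    ; σ         = σᵈ
    ; ⊗-resp-≈  = ⊗-cong
    ; ⊗-id      = ⊗-id
    ; ⊗-∘       = ⊗-∘
    ; ⊗-assoc   = square⇒≋ (∙-assoc _ _ _) (∙-assoc _ _ _) ⊗-assoc
    ; ⊗-idˡ     = square⇒≋ (∙-idˡ _) (∙-idˡ _) ⊗-idˡ
    ; ⊗-idʳ     = square⇒≋ (∙-idʳ _) (∙-idʳ _) ⊗-idʳ
    ; σ-natural = σ-natural
    ; σ-σ       = σ-σ
    ; hexagon   = ≋-trans (hetero hexagon) (conj≋ (∙-assoc _ _ _) (∙-assoc _ _ _))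
    }
    where
    open ObjectMonoid M
    cat : Category Carrier _ _
    cat = record
      { Hom      = Diagram (signature 𝓛)
      ; _≈_      = Equation 𝓛 ⊢_≈_
      ; ≈-equiv  = record { refl = ≈-refl ; sym = ≈-sym ; trans = ≈-trans }
      ; id       = idᵈ
      ; _∘_      = _∘ᵈ_
      ; ∘-resp-≈ = ∘-cong
      ; assoc    = ∘-assoc
      ; idˡ      = ∘-idˡ
      ; idʳ      = ∘-idʳ
      }
    open Category cat

  free : Signature M s → StrictSMC M _ _
  free Σ = underlying record { signature = Σ ; Equation = λ _ _ → ⊥ {0ℓ} }

-- The universal property of the free prop: generators of type a → b are
-- sent to morphisms ⟦ a ⟧₀ → ⟦ b ⟧₀.
module Interpretation
  {M : ObjectMonoid o} {N : ObjectMonoid o′} (h : ObjectHom M N)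
  {Σ : Signature M s} (Q : StrictSMC N ℓ e)
  (⟦_⟧ᵍ : ∀ {a b} → Σ [ a , b ] → StrictSMC.Hom Q (ObjectHom.⟦_⟧₀ h a) (ObjectHom.⟦_⟧₀ h b))
  where
  private
    module M = ObjectMonoid M
    module N = ObjectMonoid N
  open ObjectHom h
  open StrictSMC Q

  ⟦_⟧ : ∀ {a b} → Diagram Σ a b → Hom ⟦ a ⟧₀ ⟦ b ⟧₀
  ⟦ gen x ⟧                        = ⟦ x ⟧ᵍ
  ⟦ idᵈ ⟧                          = id
  ⟦ f ∘ᵈ g ⟧                       = ⟦ f ⟧ ∘ ⟦ g ⟧
  ⟦ _⊗ᵈ_ {a} {b} {c} {d} f g ⟧     =
    coe (sym (∙-homo b d)) ∘ (⟦ f ⟧ ⊗ ⟦ g ⟧) ∘ coe (∙-homo a c)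
  ⟦ σᵈ a b ⟧                       =
    coe (sym (∙-homo b a)) ∘ σ ⟦ a ⟧₀ ⟦ b ⟧₀ ∘ coe (∙-homo a b)

  ⟦⊗⟧ : ∀ {a b c d} (f : Diagram Σ a b) (g : Diagram Σ c d) →
        ⟦ f ⊗ᵈ g ⟧ ≋ ⟦ f ⟧ ⊗ ⟦ g ⟧
  ⟦⊗⟧ {a} {b} {c} {d} f g = conj≋ (sym (∙-homo b d)) (∙-homo a c)

  ⟦σ⟧ : ∀ a b → ⟦ σᵈ a b ⟧ ≋ σ ⟦ a ⟧₀ ⟦ b ⟧₀
  ⟦σ⟧ a b = conj≋ (sym (∙-homo b a)) (∙-homo a b)

  ⟦coe⟧ : ∀ {a b} (p : a ≡ b) → ⟦ coeᵈ p ⟧ ≋ id {⟦ b ⟧₀}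
  ⟦coe⟧ refl = ≋-refl

  coe-∘⟦⟧ : ∀ {a b c} (p : b ≡ c) {f : Hom a ⟦ b ⟧₀} → ⟦ coeᵈ p ⟧ ∘ f ≋ f
  coe-∘⟦⟧ refl = hetero idˡ

  ⟦⟧∘-coe : ∀ {a b c} (p : a ≡ b) {f : Hom ⟦ b ⟧₀ c} → f ∘ ⟦ coeᵈ p ⟧ ≋ f
  ⟦⟧∘-coe refl = hetero idʳ

  module _ {E : Equations Σ t}
           (sound : ∀ {a b} {f g : Diagram Σ a b} → E f g → ⟦ f ⟧ ≈ ⟦ g ⟧) where

    ⟦⟧-cong : ∀ {a b} {f g : Diagram Σ a b} → E ⊢ f ≈ g → ⟦ f ⟧ ≈ ⟦ g ⟧
    ⟦⟧-cong (equation p)   = sound p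
    ⟦⟧-cong ≈-refl         = ≈.refl
    ⟦⟧-cong (≈-sym p)      = ≈.sym (⟦⟧-cong p)
    ⟦⟧-cong (≈-trans p q)  = ≈.trans (⟦⟧-cong p) (⟦⟧-cong q)
    ⟦⟧-cong (∘-cong p q)   = ∘-resp-≈ (⟦⟧-cong p) (⟦⟧-cong q)
    ⟦⟧-cong (⊗-cong p q)   =
      ∘-resp-≈ ≈.refl (∘-resp-≈ (⊗-resp-≈ (⟦⟧-cong p) (⟦⟧-cong q)) ≈.refl)
    ⟦⟧-cong ∘-assoc        = assoc
    ⟦⟧-cong ∘-idˡ          = idˡ
    ⟦⟧-cong ∘-idʳ          = idʳ
    ⟦⟧-cong (⊗-id {a} {b}) = ≋⇒≈
      (≋-trans (⟦⊗⟧ (idᵈ {a = a}) (idᵈ {a = b}))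
      (≋-trans (hetero ⊗-id₁) (id-cong (sym (∙-homo a b)))))
      where ⊗-id₁ = StrictSMC.⊗-id Q
    ⟦⟧-cong (⊗-∘ {f = f} {g} {f′} {g′}) = ≋⇒≈
      (≋-trans (⟦⊗⟧ (f ∘ᵈ g) (f′ ∘ᵈ g′))
      (≋-trans (hetero (StrictSMC.⊗-∘ Q))
      (≋-sym (∘-resp-≋ (⟦⊗⟧ f f′) (⟦⊗⟧ g g′)))))
    ⟦⟧-cong (⊗-assoc {a} {a′} {b} {b′} {c} {c′} {f} {g} {k}) = ≋⇒≈
      (≋-trans (coe-∘⟦⟧ (M.∙-assoc a′ b′ c′))
      (≋-trans (⟦⊗⟧ (f ⊗ᵈ g) k)
      (≋-trans (⊗-resp-≋ (⟦⊗⟧ f g) ≋-refl)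
      (≋-trans (StrictSMC.⊗-assoc Q)
      (≋-sym
        (≋-trans (⟦⟧∘-coe (M.∙-assoc a b c))
        (≋-trans (⟦⊗⟧ f (g ⊗ᵈ k)) (⊗-resp-≋ ≋-refl (⟦⊗⟧ g k)))))))))
    ⟦⟧-cong (⊗-idˡ {a} {b} {f}) = ≋⇒≈
      (≋-trans (coe-∘⟦⟧ (M.∙-idˡ b))
      (≋-trans (⟦⊗⟧ idᵈ f)
      (≋-trans (⊗-resp-≋ (id-cong ε-homo) ≋-refl)
      (≋-trans (StrictSMC.⊗-idˡ Q)
      (≋-sym (⟦⟧∘-coe (M.∙-idˡ a)))))))
    ⟦⟧-cong (⊗-idʳ {a} {b} {f}) = ≋⇒≈
      (≋-trans (coe-∘⟦⟧ (M.∙-idʳ b))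
      (≋-trans (⟦⊗⟧ f idᵈ)
      (≋-trans (⊗-resp-≋ ≋-refl (id-cong ε-homo))
      (≋-trans (StrictSMC.⊗-idʳ Q)
      (≋-sym (⟦⟧∘-coe (M.∙-idʳ a)))))))
    ⟦⟧-cong (σ-natural {a} {a′} {b} {b′} {f} {g}) = ≋⇒≈
      (≋-trans (∘-resp-≋ (⟦σ⟧ a′ b′) (⟦⊗⟧ f g))
      (≋-trans (hetero (StrictSMC.σ-natural Q))
      (≋-sym (∘-resp-≋ (⟦⊗⟧ g f) (⟦σ⟧ a b)))))
    ⟦⟧-cong (σ-σ {a} {b})  = ≋⇒≈
      (≋-trans (∘-resp-≋ (⟦σ⟧ b a) (⟦σ⟧ a b))
      (≋-trans (hetero (StrictSMC.σ-σ Q)) (id-cong (sym (∙-homo a b)))))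
    ⟦⟧-cong (hexagon {a} {b} {c}) = ≋⇒≈
      (≋-trans
        (∘-resp-≋ (≋-trans (⟦⊗⟧ idᵈ (σᵈ a c)) (⊗-resp-≋ ≋-refl (⟦σ⟧ a c)))
          (≋-trans (coe-∘⟦⟧ (M.∙-assoc b a c))
          (≋-trans (⟦⊗⟧ (σᵈ a b) idᵈ)
          (≋-trans (⊗-resp-≋ (⟦σ⟧ a b) ≋-refl)
          (≋-sym (coe-∘ (N.∙-assoc _ _ _)))))))
      (≋-trans (StrictSMC.hexagon Q)
      (≋-sym
        (≋-trans (coe-∘⟦⟧ (M.∙-assoc b c a))
        (≋-trans (⟦⟧∘-coe (M.∙-assoc a b c))
        (≋-trans (⟦σ⟧ a (b M.∙ c)) (σ-cong refl (∙-homo b c))))))))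

    functor : StrictFunctor (underlying record { signature = Σ ; Equation = E }) Q
    functor = record
      { objects  = h
      ; F₁       = ⟦_⟧
      ; F-resp-≈ = ⟦⟧-cong
      ; F-id     = ≈.refl
      ; F-∘      = ≈.refl
      ; F-⊗      = λ {_} {_} {_} {_} {f} {g} → ⟦⊗⟧ f g
      ; F-σ      = λ {a} {b} → ⟦σ⟧ a b
      }

list-monoid : Set o → ObjectMonoid o
list-monoid C = record { Carrier = List C ; _∙_ = _++_ ; ε = [] ; isMonoid = ++-isMonoid }

-- Lists over a single color, identified with their lengths.
ℕ-monoid : ObjectMonoid 0ℓ
ℕ-monoid = record { Carrier = ℕ ; _∙_ = _+_ ; ε = 0 ; isMonoid = +-0-isMonoid }

ColoredProp : Set o → ∀ ℓ e → Set (o ⊔ lsuc (ℓ ⊔ e))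
ColoredProp C = StrictSMC (list-monoid C)

MonochromaticProp : ∀ ℓ e → Set (lsuc (ℓ ⊔ e))
MonochromaticProp = StrictSMC ℕ-monoid

ColoredLanguage : Set o → ∀ s t → Set (o ⊔ lsuc (s ⊔ t))
ColoredLanguage C = GraphicalLanguage (list-monoid C)

MonochromaticLanguage : ∀ s t → Set (lsuc (s ⊔ t))
MonochromaticLanguage = GraphicalLanguage ℕ-monoid

ℕ>0 : Set
ℕ>0 = [ n ∈ ℕ ∣ 0 < n ]

1⁺ : ℕ>0
1⁺ = 1 , irrelevant (s≤s z≤n)

1+_ : ℕ>0 → ℕ>0
1+ n = suc (value n) , irrelevant (s≤s z≤n)

Sizes : ObjectMonoid 0ℓ
Sizes = list-monoid ℕ>0

infix 11 _·_
_·_ : ℕ → ℕ>0 → List ℕ>0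
k · n = replicate k n

∣_∣ : List ℕ>0 → ℕ
∣ a ∣ = sum (map value a)

∣++∣ : ∀ a b → ∣ a ++ b ∣ ≡ ∣ a ∣ + ∣ b ∣
∣++∣ a b = trans (cong sum (map-++ value a b)) (sum-++ (map value a) (map value b))

∣·1∣ : ∀ n → ∣ n · 1⁺ ∣ ≡ n
∣·1∣ zero    = refl
∣·1∣ (suc n) = cong suc (∣·1∣ n)

+-·1 : ∀ m n → (m + n) · 1⁺ ≡ m · 1⁺ ++ n · 1⁺
+-·1 zero    n = refl
+-·1 (suc m) n = cong (1⁺ ∷_) (+-·1 m n)

global-size : ObjectHom Sizes ℕ-monoid
global-size = record { ⟦_⟧₀ = ∣_∣ ; ∙-homo = ∣++∣ ; ε-homo = refl }

size-1-wires : ObjectHom ℕ-monoid Sizes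
size-1-wires = record { ⟦_⟧₀ = _· 1⁺ ; ∙-homo = +-·1 ; ε-homo = refl }

𝟏 : ColoredProp ℕ>0 0ℓ 0ℓ
𝟏 = codiscrete Sizes

𝐍 : MonochromaticProp 0ℓ 0ℓ
𝐍 = codiscrete ℕ-monoid

sizeFunctor : StrictFunctor 𝟏 𝐍
sizeFunctor = into-codiscrete 𝟏 global-size

module Scalable (𝓛 : MonochromaticLanguage s t) where
  open GraphicalLanguage 𝓛

  𝐋 : MonochromaticProp _ _
  𝐋 = underlying 𝓛

  private module 𝐋 = StrictSMC 𝐋

  data SGenerator : List ℕ>0 → List ℕ>0 → Set s where
    δ  : ∀ n → SGenerator (1 · (1+ n)) (1 · 1⁺ ++ 1 · n)
    γ  : ∀ n → SGenerator (1 · 1⁺ ++ 1 · n) (1 · (1+ n))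
    ⌜_⌝ : ∀ {n m} → signature [ n , m ] → SGenerator (n · 1⁺) (m · 1⁺)

  S-signature : Signature Sizes s
  S-signature = record { _[_,_] = SGenerator }

  open Interpretation size-1-wires (free S-signature) (λ x → gen ⌜ x ⌝)
    public using () renaming (⟦_⟧ to onSize1)

  data SEquation : Equations S-signature (s ⊔ t) where
    γ-δ : ∀ n → SEquation (gen (γ n) ∘ᵈ gen (δ n)) idᵈ
    δ-γ : ∀ n → SEquation (gen (δ n) ∘ᵈ gen (γ n)) (idᵈ {a = 1 · 1⁺} ⊗ᵈ idᵈ {a = 1 · n})
    ⌜_⌝ : ∀ {n m} {f g : Diagram signature n m} →
          Equation f g → SEquation (onSize1 f) (onSize1 g)

  𝓢𝓛 : ColoredLanguage ℕ>0 s (s ⊔ t)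
  𝓢𝓛 = record { signature = S-signature ; Equation = SEquation }

  𝓢𝐋 : ColoredProp ℕ>0 _ _
  𝓢𝐋 = underlying 𝓢𝓛

  -- The objects 1 · (1+ n) and 1 · 1⁺ ++ 1 · n have definitionally equal
  -- global sizes.
  strip : ∀ {a b} → SGenerator a b → 𝐋.Hom ∣ a ∣ ∣ b ∣
  strip (δ n)             = idᵈ
  strip (γ n)             = idᵈ
  strip (⌜_⌝ {n} {m} x)   = 𝐋.coe (sym (∣·1∣ m)) 𝐋.∘ gen x 𝐋.∘ 𝐋.coe (∣·1∣ n)

  module Strip = Interpretation global-size 𝐋 (λ {a} {b} → strip {a} {b})

  strip-onSize1 : ∀ {n m} (f : Diagram signature n m) → Strip.⟦ onSize1 f ⟧ 𝐋.≋ f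
  strip-onSize1 (gen {n} {m} x) = 𝐋.conj≋ (sym (∣·1∣ m)) (∣·1∣ n)
  strip-onSize1 (idᵈ {n}) = 𝐋.id-cong (∣·1∣ n)
  strip-onSize1 (f ∘ᵈ g) = 𝐋.∘-resp-≋ (strip-onSize1 f) (strip-onSize1 g)
  strip-onSize1 (_⊗ᵈ_ {a} {b} {c} {d} f g) = 𝐋.≋-trans
    (Strip.coe-∘⟦⟧ (sym (+-·1 b d)))
    (𝐋.≋-trans (Strip.⟦⟧∘-coe (+-·1 a c))
    (𝐋.≋-trans (Strip.⟦⊗⟧ (onSize1 f) (onSize1 g))
    (𝐋.⊗-resp-≋ (strip-onSize1 f) (strip-onSize1 g))))
  strip-onSize1 (σᵈ a b) = 𝐋.≋-trans
    (Strip.coe-∘⟦⟧ (sym (+-·1 b a)))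
    (𝐋.≋-trans (Strip.⟦⟧∘-coe (+-·1 a b))
    (𝐋.≋-trans (Strip.⟦σ⟧ (a · 1⁺) (b · 1⁺)) (𝐋.σ-cong (∣·1∣ a) (∣·1∣ b))))

  strip-sound : ∀ {a b} {f g : Diagram S-signature a b} →
                SEquation f g → Strip.⟦ f ⟧ 𝐋.≈ Strip.⟦ g ⟧
  strip-sound (γ-δ n) = ∘-idˡ
  strip-sound (δ-γ n) = ≈-trans ∘-idˡ (≈-sym (𝐋.≋⇒≈ (𝐋.≋-trans
    (Strip.⟦⊗⟧ (idᵈ {a = 1 · 1⁺}) (idᵈ {a = 1 · n}))
    (𝐋.≋-trans (𝐋.hetero ⊗-id) (𝐋.id-cong (sym (∣++∣ (1 · 1⁺) (1 · n))))))))
  strip-sound (⌜_⌝ {f = f} {g} p) = 𝐋.≋⇒≈ (𝐋.≋-trans (strip-onSize1 f)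
    (𝐋.≋-trans (𝐋.hetero (equation p)) (𝐋.≋-sym (strip-onSize1 g))))

  wireStripper : StrictFunctor 𝓢𝐋 𝐋
  wireStripper = Strip.functor strip-sound

open StrictFunctor public using () renaming (symmetricMonoidalFunctor to ⌊_⌋)

{-# OPTIONS --safe #-}
module Submission where

-- The square is a pullback because the wire stripper is fully faithful: a
-- functor into 𝓢𝐋 is then the same as its action on objects together with a
-- compatible functor into 𝐋.  Full faithfulness holds because the dividers
-- assemble into isomorphisms split a : a → ∣ a ∣ · 1⁺ that are stripped to
-- identities, and these are natural: split b ∘ f ≈ embed (strip f) ∘ split a,
-- by induction on the diagram f, where embed : 𝐋 → 𝓢𝐋 reads a diagram on
-- wires of size 1.

open import Data.Irrelevant using () renaming ([_] to irrelevant)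
open import Data.List.Base using ([]; _∷_; _++_)
open import Data.Nat.Base using (ℕ; zero; suc; z≤n; s≤s)
open import Data.Product.Base using () renaming (_,_ to _,′_)
open import Data.Refinement using (_,_; value)
open import Data.Unit.Polymorphic.Base using (tt)
open import Level using (Level; _⊔_)
open import Relation.Binary.PropositionalEquality
  using (_≡_; refl; sym; trans; cong; cong₂; subst₂)

open import Defs hiding (⊗-id; ⊗-∘; ⊗-assoc; ⊗-idˡ; ⊗-idʳ; σ-natural)

private
  variable
    o ℓ e o′ ℓ′ e′ s t : Level

_⁺ : ℕ → ℕ>0
k ⁺ = suc k , irrelevant (s≤s z≤n)

module _ {Obj : Set o} (C : Category Obj ℓ e) where
  open Category C

  ≋⇒dom-≡ : ∀ {a b c d} {f : Hom a b} {g : Hom c d} → f ≋ g → a ≡ c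
  ≋⇒dom-≡ (hetero _) = refl

-- Fully faithful strict functors yield pullback squares.

module _ {M : ObjectMonoid o} {N : ObjectMonoid o′}
         {P : StrictSMC M ℓ e} {Q : StrictSMC N ℓ′ e′} (F : StrictFunctor P Q) where
  private
    module M = ObjectMonoid M
    module N = ObjectMonoid N
    module P = StrictSMC P
    module Q = StrictSMC Q
    module F = StrictFunctor F
  open F using (F₁)
  open ObjectHom F.objects

  F-resp-≋ : ∀ {a b c d} {f : P.Hom a b} {g : P.Hom c d} → f P.≋ g → F₁ f Q.≋ F₁ g
  F-resp-≋ (P.hetero p) = Q.hetero (F.F-resp-≈ p)

  record FullyFaithful : Set (o ⊔ ℓ ⊔ e ⊔ ℓ′ ⊔ e′) where
    field
      lift     : ∀ {a b} → Q.Hom ⟦ a ⟧₀ ⟦ b ⟧₀ → P.Hom a b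
      F-lift   : ∀ {a b} (f : Q.Hom ⟦ a ⟧₀ ⟦ b ⟧₀) → F₁ (lift f) Q.≈ f
      faithful : ∀ {a b} {f g : P.Hom a b} → F₁ f Q.≈ F₁ g → f P.≈ g

  module FullyFaithful⇒Pullback (ff : FullyFaithful) where
    open FullyFaithful ff

    -- `F` need not be injective on objects, so equality of the endpoints in `P` cannot be recovered
    -- from the images and has to be supplied.
    faithful≋ : ∀ {a b c d} {f : P.Hom a b} {g : P.Hom c d} →
                a ≡ c → b ≡ d → F₁ f Q.≋ F₁ g → f P.≋ g
    faithful≋ refl refl p = P.hetero (faithful (Q.≋⇒≈ p))

    -- The outer square identifies objects of `Q` only propositionally, so lifting must be possible
    -- along such equalities.
    liftAlong : ∀ {a b x y} → ⟦ a ⟧₀ ≡ x → ⟦ b ⟧₀ ≡ y → Q.Hom x y → P.Hom a b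
    liftAlong refl refl = lift

    F-liftAlong : ∀ {a b x y} (p : ⟦ a ⟧₀ ≡ x) (q : ⟦ b ⟧₀ ≡ y) (f : Q.Hom x y) →
                  F₁ (liftAlong p q f) Q.≋ f
    F-liftAlong refl refl f = Q.hetero (F-lift f)

    -- By faithfulness, equations in P need only be verified on images.
    infix 4 _↝_
    _↝_ : ∀ {a b x y} → P.Hom a b → Q.Hom x y → Set _
    f ↝ φ = F₁ f Q.≋ φ

    -- The common shape of the laws of the mediating functor: both sides lie over the two sides of a
    -- law of `v`, which faithfulness reflects.
    ↝-equation : ∀ {a b x y} {f g : P.Hom a b} {φ ψ : Q.Hom x y} →
                 f ↝ φ → φ Q.≈ ψ → g ↝ ψ → f P.≈ g
    ↝-equation p q r = faithful (Q.≋⇒≈ (Q.≋-trans p (Q.≋-trans (Q.hetero q) (Q.≋-sym r))))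

    ↝-id : ∀ {a x} → ⟦ a ⟧₀ ≡ x → P.id {a} ↝ Q.id {x}
    ↝-id refl = Q.hetero F.F-id

    infixr 9 _↝-∘_
    _↝-∘_ : ∀ {a b c x y z} {f : P.Hom b c} {g : P.Hom a b} {φ : Q.Hom y z} {ψ : Q.Hom x y} →
            f ↝ φ → g ↝ ψ → f P.∘ g ↝ φ Q.∘ ψ
    p ↝-∘ q = Q.≋-trans (Q.hetero F.F-∘) (Q.∘-resp-≋ p q)

    infixr 10 _↝-⊗_
    _↝-⊗_ : ∀ {a b c d x y z w} {f : P.Hom a b} {g : P.Hom c d}
            {φ : Q.Hom x y} {ψ : Q.Hom z w} →
            f ↝ φ → g ↝ ψ → f P.⊗ g ↝ φ Q.⊗ ψ
    p ↝-⊗ q = Q.≋-trans F.F-⊗ (Q.⊗-resp-≋ p q)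

    ↝-σ : ∀ {a b x y} → ⟦ a ⟧₀ ≡ x → ⟦ b ⟧₀ ≡ y → P.σ a b ↝ Q.σ x y
    ↝-σ refl refl = F.F-σ

    -- Associators and unitors of strict categories are coercions, hence match as soon as their
    -- targets do.
    ↝-coe : ∀ {a b x y} (p : a ≡ b) (q : x ≡ y) → ⟦ b ⟧₀ ≡ y → P.coe p ↝ Q.coe q
    ↝-coe p q r = Q.≋-trans (F.F-coe p) (Q.≋-trans (Q.id-cong r) (Q.≋-sym (Q.coe≋id q)))

    ⟦∙⟧ : ∀ {a b x y} → ⟦ a ⟧₀ ≡ x → ⟦ b ⟧₀ ≡ y → ⟦ a M.∙ b ⟧₀ ≡ x N.∙ y
    ⟦∙⟧ {a} {b} p q = trans (∙-homo a b) (cong₂ N._∙_ p q)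

    liftIso : ∀ {a b x y} → ⟦ a ⟧₀ ≡ x → ⟦ b ⟧₀ ≡ y → Q.Iso x y → P.Iso a b
    liftIso p q i = record
      { to   = liftAlong p q (Q.to i)
      ; from = liftAlong q p (Q.from i)
      ; isoˡ = ↝-equation (F-liftAlong q p _ ↝-∘ F-liftAlong p q _) (Q.isoˡ i) (↝-id p)
      ; isoʳ = ↝-equation (F-liftAlong p q _ ↝-∘ F-liftAlong q p _) (Q.isoʳ i) (↝-id q)
      }

    private
      size : StrictFunctor (codiscrete M) (codiscrete N)
      size = into-codiscrete (codiscrete M) F.objects

    -- The mediating functor and its uniqueness.

    module Mediator {oK ℓK eK} {K : SymmetricMonoidalCategory oK ℓK eK}
      (u : SymmetricMonoidalFunctor K (StrictSMC.symmetricMonoidalCategory (codiscrete M)))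
      (v : SymmetricMonoidalFunctor K Q.symmetricMonoidalCategory)
      (comm : ⌊ size ⌋ ∘F u ≃ ⌊ ! Q ⌋ ∘F v) where
      private
        module K = SymmetricMonoidalCategory K
        module u = SymmetricMonoidalFunctor u
        module v = SymmetricMonoidalFunctor v

      ob : ∀ a → ⟦ u.F₀ a ⟧₀ ≡ v.F₀ a
      ob = _≃_.F₀-≡ comm

      ob∙ : ∀ a b → ⟦ u.F₀ a M.∙ u.F₀ b ⟧₀ ≡ v.F₀ a N.∙ v.F₀ b
      ob∙ a b = ⟦∙⟧ (ob a) (ob b)

      h₁ : ∀ {a b} → K.Hom a b → P.Hom (u.F₀ a) (u.F₀ b)
      h₁ {a} {b} f = liftAlong (ob a) (ob b) (v.F₁ f)

      h-ε : P.Iso M.ε (u.F₀ K.unit)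
      h-ε = liftIso ε-homo (ob K.unit) v.ε-iso

      h-μ : ∀ a b → P.Iso (u.F₀ a M.∙ u.F₀ b) (u.F₀ (a K.⊗₀ b))
      h-μ a b = liftIso (ob∙ a b) (ob (a K.⊗₀ b)) (v.μ-iso a b)

      ↝-h₁ : ∀ {a b} (f : K.Hom a b) → h₁ f ↝ v.F₁ f
      ↝-h₁ {a} {b} f = F-liftAlong (ob a) (ob b) (v.F₁ f)

      ↝-ε : P.to h-ε ↝ v.ε
      ↝-ε = F-liftAlong ε-homo (ob K.unit) v.ε

      ↝-μ : ∀ a b → P.to (h-μ a b) ↝ v.μ a b
      ↝-μ a b = F-liftAlong (ob∙ a b) (ob (a K.⊗₀ b)) (v.μ a b)

      h : SymmetricMonoidalFunctor K P.symmetricMonoidalCategory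
      h = record
        { F₀        = u.F₀
        ; F₁        = h₁
        ; F-resp-≈  = λ p → ↝-equation (↝-h₁ _) (v.F-resp-≈ p) (↝-h₁ _)
        ; F-id      = λ {a} → ↝-equation (↝-h₁ _) v.F-id (↝-id (ob a))
        ; F-∘       = ↝-equation (↝-h₁ _) v.F-∘ (↝-h₁ _ ↝-∘ ↝-h₁ _)
        ; ε-iso     = h-ε
        ; μ-iso     = h-μ
        ; μ-natural = λ {a} {a′} {b} {b′} {f} {g} → ↝-equation
            (↝-μ a′ b′ ↝-∘ (↝-h₁ f ↝-⊗ ↝-h₁ g)) v.μ-natural (↝-h₁ (f K.⊗₁ g) ↝-∘ ↝-μ a b)
        ; μ-assoc   = λ {a} {b} {c} → ↝-equation
            (↝-h₁ (K.α a b c) ↝-∘ ↝-μ (a K.⊗₀ b) c ↝-∘ (↝-μ a b ↝-⊗ ↝-id (ob c)))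
            v.μ-assoc
            (↝-μ a (b K.⊗₀ c) ↝-∘ (↝-id (ob a) ↝-⊗ ↝-μ b c) ↝-∘
              ↝-coe (M.∙-assoc _ _ _) (N.∙-assoc _ _ _) (⟦∙⟧ (ob a) (ob∙ b c)))
        ; μ-unitˡ   = λ {a} → ↝-equation
            (↝-h₁ (K.λ⇒ a) ↝-∘ ↝-μ K.unit a ↝-∘ (↝-ε ↝-⊗ ↝-id (ob a)))
            v.μ-unitˡ
            (↝-coe (M.∙-idˡ _) (N.∙-idˡ _) (ob a))
        ; μ-unitʳ   = λ {a} → ↝-equation
            (↝-h₁ (K.ρ⇒ a) ↝-∘ ↝-μ a K.unit ↝-∘ (↝-id (ob a) ↝-⊗ ↝-ε))
            v.μ-unitʳ
            (↝-coe (M.∙-idʳ _) (N.∙-idʳ _) (ob a))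
        ; μ-σ       = λ {a} {b} → ↝-equation
            (↝-h₁ (K.σ a b) ↝-∘ ↝-μ a b) v.μ-σ (↝-μ b a ↝-∘ ↝-σ (ob a) (ob b))
        }

      h-strict : IsStrict u → IsStrict v → IsStrict h
      h-strict u-strict v-strict = record
        -- In a codiscrete category `≋` says only that endpoints agree, so strictness of `u`
        -- supplies exactly the object equality that `faithful≋` asks for.
        { ε-strict = faithful≋ (≋⇒dom-≡ 𝟙 (ε-strict u-strict)) refl
            (Q.≋-trans ↝-ε (Q.≋-trans (ε-strict v-strict) (Q.≋-sym (↝-id (ob K.unit)))))
        ; μ-strict = λ a b → faithful≋ (≋⇒dom-≡ 𝟙 (μ-strict u-strict a b)) refl
            (Q.≋-trans (↝-μ a b)
            (Q.≋-trans (μ-strict v-strict a b) (Q.≋-sym (↝-id (ob (a K.⊗₀ b))))))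
        }
        where
        𝟙 = StrictSMC.category (codiscrete M)
        open IsStrict

      h-ofKind : ∀ κ → OfKind κ u → OfKind κ v → OfKind κ h
      h-ofKind strong _        _        = tt
      h-ofKind strict u-strict v-strict = h-strict u-strict v-strict

      !∘h≃u : ⌊ ! P ⌋ ∘F h ≃ u
      !∘h≃u = record
        { F₀-≡ = λ _ → refl
        ; F₁-≋ = λ _ → hetero refl
        ; ε-≋  = hetero refl
        ; μ-≋  = λ _ _ → hetero refl
        }
        where open StrictSMC (codiscrete M) using (hetero)

      F∘h≃v : ⌊ F ⌋ ∘F h ≃ v
      F∘h≃v = record
        { F₀-≡ = ob
        ; F₁-≋ = ↝-h₁
        -- The unit of the composite is the image of the unit of `h` preceded by the coercion that
        -- is the unit of `⌊ F ⌋`.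
        ; ε-≋  = Q.≋-trans (Q.∘-coe (sym ε-homo)) ↝-ε
        ; μ-≋  = λ a b → Q.≋-trans (Q.∘-coe (sym (∙-homo _ _))) (↝-μ a b)
        }

      -- The first triangle fixes `k` on objects; given that, faithfulness lets the second fix its
      -- morphisms and structure maps.
      unique : (k : SymmetricMonoidalFunctor K P.symmetricMonoidalCategory) →
               ⌊ ! P ⌋ ∘F k ≃ u → ⌊ F ⌋ ∘F k ≃ v → h ≃ k
      unique k !∘k≃u F∘k≃v = record
        { F₀-≡ = ob-k
        ; F₁-≋ = λ {a} {b} f → faithful≋ (ob-k a) (ob-k b)
            (Q.≋-trans (↝-h₁ f) (Q.≋-sym (F∘k.F₁-≋ f)))
        ; ε-≋  = faithful≋ refl (ob-k K.unit)
            (Q.≋-trans ↝-ε (Q.≋-trans (Q.≋-sym F∘k.ε-≋) (Q.∘-coe (sym ε-homo))))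
        ; μ-≋  = λ a b → faithful≋ (cong₂ M._∙_ (ob-k a) (ob-k b)) (ob-k (a K.⊗₀ b))
            (Q.≋-trans (↝-μ a b)
            (Q.≋-trans (Q.≋-sym (F∘k.μ-≋ a b)) (Q.∘-coe (sym (∙-homo _ _)))))
        }
        where
        module F∘k = _≃_ F∘k≃v
        ob-k : ∀ a → u.F₀ a ≡ SymmetricMonoidalFunctor.F₀ k a
        ob-k a = sym (_≃_.F₀-≡ !∘k≃u a)

    isPullback : ∀ {oK ℓK eK} (κ : FunctorKind) →
                 IsPullback κ oK ℓK eK ⌊ ! P ⌋ ⌊ F ⌋ ⌊ size ⌋ ⌊ ! Q ⌋
    isPullback κ = record
      { commutes  = record
        { F₀-≡ = λ _ → refl
        ; F₁-≋ = λ _ → hetero refl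
        ; ε-≋  = hetero refl
        ; μ-≋  = λ _ _ → hetero refl
        }
      ; universal = λ u v u-kind v-kind comm →
          let open Mediator u v comm in
          h ,′ (h-ofKind κ u-kind v-kind ,′ !∘h≃u ,′ F∘h≃v) ,′
          λ {k} (_ ,′ !∘k≃u ,′ F∘k≃v) → unique k !∘k≃u F∘k≃v
      }
      where open StrictSMC (codiscrete N) using (hetero)

module IsoTensor {M : ObjectMonoid o} (P : StrictSMC M ℓ e) where
  open ObjectMonoid M
  open StrictSMC P

  infixr 10 _⊗ᵢ_
  _⊗ᵢ_ : ∀ {a b c d} → Iso a b → Iso c d → Iso (a ∙ c) (b ∙ d)
  i ⊗ᵢ j = record
    { to   = to i ⊗ to j
    ; from = from i ⊗ from j
    ; isoˡ = ≈.trans (≈.sym ⊗-∘) (≈.trans (⊗-resp-≈ (isoˡ i) (isoˡ j)) ⊗-id)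
    ; isoʳ = ≈.trans (≈.sym ⊗-∘) (≈.trans (⊗-resp-≈ (isoʳ i) (isoʳ j)) ⊗-id)
    }

module _ (𝓛 : MonochromaticLanguage s t) where
  open GraphicalLanguage 𝓛
  open Scalable 𝓛
  private
    module 𝐋 = StrictSMC 𝐋
  open StrictSMC 𝓢𝐋
  open IsoTensor 𝓢𝐋

  private
    infixr 5 _⟫_
    _⟫_ : ∀ {a b c d a′ b′} {f : Hom a b} {g : Hom c d} {h : Hom a′ b′} →
          f ≋ g → g ≋ h → f ≋ h
    _⟫_ = ≋-trans

  -- Embedding the original prop on wires of size 1.

  module Embed = Interpretation size-1-wires 𝓢𝐋 (λ x → gen ⌜ x ⌝)

  -- The equations of 𝓢𝓛 are stated with onSize1, which takes values in the
  -- free prop; its morphisms are the same terms as those of 𝓢𝐋.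
  embed≡onSize1 : ∀ {n m} (f : Diagram signature n m) → Embed.⟦ f ⟧ ≡ onSize1 f
  embed≡onSize1 (gen x)   = refl
  embed≡onSize1 idᵈ       = refl
  embed≡onSize1 (f ∘ᵈ g)  = cong₂ _∘ᵈ_ (embed≡onSize1 f) (embed≡onSize1 g)
  embed≡onSize1 (_⊗ᵈ_ {a} {b} {c} {d} f g) =
    cong₂ (λ x y → coe (sym (+-·1 b d)) ∘ (x ⊗ y) ∘ coe (+-·1 a c))
      (embed≡onSize1 f) (embed≡onSize1 g)
  embed≡onSize1 (σᵈ a b)  = refl

  embedding : StrictFunctor 𝐋 𝓢𝐋
  embedding = Embed.functor λ {_} {_} {f} {g} p →
    subst₂ _≈_ (sym (embed≡onSize1 f)) (sym (embed≡onSize1 g)) (equation ⌜ p ⌝)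

  embed-resp-≋ : ∀ {a b c d} {f : 𝐋.Hom a b} {g : 𝐋.Hom c d} →
                 f 𝐋.≋ g → Embed.⟦ f ⟧ ≋ Embed.⟦ g ⟧
  embed-resp-≋ = F-resp-≋ embedding

  strip-embed : ∀ {n m} (f : Diagram signature n m) → Strip.⟦ Embed.⟦ f ⟧ ⟧ 𝐋.≋ f
  strip-embed f rewrite embed≡onSize1 f = strip-onSize1 f

  -- Splitting wires completely into wires of size 1.

  dividerIso : ∀ n → Iso (1 · (1+ n)) (1 · 1⁺ ++ 1 · n)
  dividerIso n = record
    { to   = gen (δ n)
    ; from = gen (γ n)
    ; isoˡ = equation (γ-δ n)
    ; isoʳ = ≈.trans (equation (δ-γ n)) ⊗-id
    }

  -- Wires have positive size, so the recursion runs on the predecessor: each divider peels off one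
  -- wire of size 1, until the remaining wire itself has size 1.
  splitWire⁺ : ∀ k → Iso (1 · k ⁺) (suc k · 1⁺)
  splitWire⁺ zero    = coe-iso refl
  splitWire⁺ (suc k) = _⊗ᵢ_ {1 · 1⁺} (coe-iso refl) (splitWire⁺ k) ∘ᵢ dividerIso (k ⁺)

  splitWire : ∀ n → Iso (1 · n) (value n · 1⁺)
  splitWire (zero  , irrelevant ())
  -- The positivity proof is irrelevant, so the argument is definitionally `k ⁺`.
  splitWire (suc k , _) = splitWire⁺ k

  split : ∀ a → Iso a (∣ a ∣ · 1⁺)
  split []      = coe-iso refl
  split (n ∷ a) = coe-iso (sym (+-·1 (value n) ∣ a ∣)) ∘ᵢ (splitWire n ⊗ᵢ split a)

  split-∷ : ∀ n a → to (split (n ∷ a)) ≋ to (splitWire n) ⊗ to (split a)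
  split-∷ n a = coe-∘ (sym (+-·1 (value n) ∣ a ∣))

  split-wire : ∀ n → to (split (1 · n)) ≋ to (splitWire n)
  split-wire n = split-∷ n [] ⟫ ⊗-idʳ

  splitWire-1+ : ∀ n → to (splitWire (1+ n)) ≈ (id {1 · 1⁺} ⊗ to (splitWire n)) ∘ gen (δ n)
  splitWire-1+ (zero  , irrelevant ())
  splitWire-1+ (suc k , _) = ≈.refl

  -- Monoidality of the splitting, which handles tensors and symmetries in `split-natural`.
  split-++ : ∀ a b → to (split (a ++ b)) ≋ to (split a) ⊗ to (split b)
  split-++ []      b = ≋-sym ⊗-idˡ
  split-++ (n ∷ a) b =
    split-∷ n (a ++ b) ⟫
    ⊗-resp-≋ ≋-refl (split-++ a b) ⟫
    ≋-sym ⊗-assoc ⟫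
    ⊗-resp-≋ (≋-sym (split-∷ n a)) ≋-refl

  split-·1 : ∀ n → to (split (n · 1⁺)) ≋ id {n · 1⁺}
  split-·1 zero    = ≋-refl
  split-·1 (suc n) = split-∷ 1⁺ (n · 1⁺) ⟫ ⊗-id≋ ≋-refl (split-·1 n)

  -- A complete splitting of a wire of size `1+ n` begins with `δ n`. As `δ n` is stripped to an
  -- identity, this is naturality at the divider.
  splitWire-δ : ∀ n → to (split (1 · 1⁺ ++ 1 · n)) ∘ gen (δ n) ≋ to (split (1 · (1+ n)))
  splitWire-δ n =
    ∘-resp-≋ (split-∷ 1⁺ (1 · n) ⟫ ⊗-resp-≋ ≋-refl (split-wire n)) ≋-refl ⟫
    hetero (≈.sym (splitWire-1+ n)) ⟫
    ≋-sym (split-wire (1+ n))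

  split-natural : ∀ {a b} (f : Diagram S-signature a b) →
                  to (split b) ∘ f ≋ Embed.⟦ Strip.⟦ f ⟧ ⟧ ∘ to (split a)
  split-natural (gen (δ n)) = splitWire-δ n ⟫ ≋-sym (hetero idˡ)
  split-natural (gen (γ n)) =
    -- Factoring the splitting through `δ n` exposes `δ n` after `γ n`, which cancels.
    ∘-resp-≋ (≋-sym (splitWire-δ n)) ≋-refl ⟫
    hetero assoc ⟫
    ∘-resp-≋ ≋-refl (hetero (isoʳ (dividerIso n))) ⟫
    hetero idʳ ⟫
    ≋-sym (hetero idˡ)
  split-natural (gen (⌜_⌝ {n} {m} x)) =
    ∘-resp-≋ (split-·1 m) ≋-refl ⟫
    hetero idˡ ⟫
    ≋-sym (hetero idʳ) ⟫
    -- Stripping only wraps `x` in coercions, invisible to `≋`, and embedding `gen x` returns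
    -- `gen ⌜ x ⌝`.
    ∘-resp-≋ (embed-resp-≋ (𝐋.≋-sym (𝐋.conj≋ (sym (∣·1∣ m)) (∣·1∣ n) {gen x})))
      (≋-sym (split-·1 n))
  split-natural idᵈ = hetero idʳ ⟫ ≋-sym (hetero idˡ)
  split-natural (f ∘ᵈ g) =
    ≋-sym (hetero assoc) ⟫
    ∘-resp-≋ (split-natural f) ≋-refl ⟫
    hetero assoc ⟫
    ∘-resp-≋ ≋-refl (split-natural g) ⟫
    ≋-sym (hetero assoc)
  split-natural (_⊗ᵈ_ {a} {b} {c} {d} f g) =
    ∘-resp-≋ (split-++ b d) ≋-refl ⟫
    ≋-sym (hetero ⊗-∘) ⟫
    ⊗-resp-≋ (split-natural f) (split-natural g) ⟫
    hetero ⊗-∘ ⟫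
    ∘-resp-≋
      (≋-sym (embed-resp-≋ (Strip.⟦⊗⟧ f g) ⟫ Embed.⟦⊗⟧ Strip.⟦ f ⟧ Strip.⟦ g ⟧))
      (≋-sym (split-++ a c))
  split-natural (σᵈ a b) =
    ∘-resp-≋ (split-++ b a) ≋-refl ⟫
    ≋-sym (hetero σ-natural) ⟫
    ∘-resp-≋
      (≋-sym (embed-resp-≋ (Strip.⟦σ⟧ a b) ⟫ Embed.⟦σ⟧ ∣ a ∣ ∣ b ∣))
      (≋-sym (split-++ a b))

  -- Full faithfulness of the wire stripper.

  strip-splitWire⁺ : ∀ k → Strip.⟦ to (splitWire⁺ k) ⟧ 𝐋.≋ 𝐋.id {suc k}
  strip-splitWire⁺ zero    = 𝐋.≋-refl
  strip-splitWire⁺ (suc k) = 𝐋.≋-trans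
    -- The right-hand factor is the stripped divider, an identity.
    (𝐋.hetero 𝐋.idʳ)
    (𝐋.≋-trans (Strip.⟦⊗⟧ (id {1 · 1⁺}) (to (splitWire⁺ k)))
    (𝐋.⊗-id≋ (𝐋.≋-refl {f = 𝐋.id {1}}) (strip-splitWire⁺ k)))

  strip-splitWire : ∀ n → Strip.⟦ to (splitWire n) ⟧ 𝐋.≋ 𝐋.id {value n}
  strip-splitWire (zero  , irrelevant ())
  strip-splitWire (suc k , _) = strip-splitWire⁺ k

  strip-split : ∀ a → Strip.⟦ to (split a) ⟧ 𝐋.≋ 𝐋.id {∣ a ∣}
  strip-split []      = 𝐋.≋-refl
  strip-split (n ∷ a) = 𝐋.≋-trans
    (Strip.coe-∘⟦⟧ (sym (+-·1 (value n) ∣ a ∣)))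
    (𝐋.≋-trans (Strip.⟦⊗⟧ (to (splitWire n)) (to (split a)))
    (𝐋.⊗-id≋ (strip-splitWire n) (strip-split a)))

  -- The inverse of a morphism stripped to an identity is stripped to an identity too, so no second
  -- induction is needed.
  strip-merge : ∀ a → Strip.⟦ from (split a) ⟧ 𝐋.≋ 𝐋.id {∣ a ∣}
  strip-merge a = 𝐋.≋-trans
    (𝐋.≋-sym (𝐋.hetero 𝐋.idʳ))
    (𝐋.≋-trans
      (𝐋.∘-resp-≋ 𝐋.≋-refl
        (𝐋.≋-sym (𝐋.≋-trans (strip-split a) (𝐋.id-cong (sym (∣·1∣ ∣ a ∣))))))
      (F-resp-≋ wireStripper (hetero (isoˡ (split a)))))

  unstrip : ∀ {a b} → 𝐋.Hom ∣ a ∣ ∣ b ∣ → Hom a b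
  unstrip {a} {b} f = from (split b) ∘ Embed.⟦ f ⟧ ∘ to (split a)

  strip-unstrip : ∀ {a b} (f : 𝐋.Hom ∣ a ∣ ∣ b ∣) → Strip.⟦ unstrip {a} {b} f ⟧ 𝐋.≈ f
  strip-unstrip {a} {b} f = 𝐋.≋⇒≈ (𝐋.≋-trans
    (𝐋.∘-resp-≋ (strip-merge b) (𝐋.∘-resp-≋ (strip-embed f) (strip-split a)))
    (𝐋.hetero (𝐋.≈.trans 𝐋.idˡ 𝐋.idʳ)))

  -- Naturality moves the splitting to the other side of `f`, where it cancels against its inverse.
  unstrip-strip : ∀ {a b} (f : Hom a b) → unstrip {a} {b} Strip.⟦ f ⟧ ≈ f
  unstrip-strip {a} {b} f = ≋⇒≈ (
    ∘-resp-≋ ≋-refl (≋-sym (split-natural f)) ⟫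
    ≋-sym (hetero assoc) ⟫
    ∘-resp-≋ (hetero (isoˡ (split b))) ≋-refl ⟫
    hetero idˡ)

  wireStripper-fullyFaithful : FullyFaithful wireStripper
  wireStripper-fullyFaithful = record
    { lift     = λ {a} {b} → unstrip {a} {b}
    ; F-lift   = λ {a} {b} → strip-unstrip {a} {b}
    -- Unstripping respects equality because the embedding does, so a left inverse of stripping
    -- makes it faithful.
    ; faithful = λ {a} {b} {f} {g} p → ≈.trans (≈.sym (unstrip-strip f))
        (≈.trans (∘-resp-≈ ≈.refl (∘-resp-≈ (StrictFunctor.F-resp-≈ embedding p) ≈.refl))
        (unstrip-strip g))
    }

lemma6 : ∀ {s t o ℓ e} (κ : FunctorKind) (𝓛 : MonochromaticLanguage s t) →
    let open Scalable 𝓛 in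
    IsPullback κ o ℓ e
    ⌊ ! 𝓢𝐋 ⌋ ⌊ wireStripper ⌋
    ⌊ sizeFunctor ⌋ ⌊ ! 𝐋 ⌋
-- The object map of `wireStripper` is `global-size`, so the general square has `sizeFunctor` as its
-- lower side by definition.
lemma6 κ 𝓛 = FullyFaithful⇒Pullback.isPullback wireStripper (wireStripper-fullyFaithful 𝓛) κ
  where open Scalable 𝓛
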